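{- Let $\mathcal A=(A,\le,\mathrm{app},\mathrm{imp},\mathsf k,\mathsf s,\Phi)$ be a full adjunction implicative ordered combinatory algebra. Define $\mathcal K_{\mathcal A\bullet}=(\Lambda,\Pi,\perp,\mathrm{app},\mathrm{push},\mathsf K,\mathsf S,\mathrm{QP})$ by $\Lambda=\Pi=A$; $s\perp\pi$ iff $s\le\pi$; $\mathrm{app}(s,t)=st$; $\mathrm{push}(s,\pi)=s\to\pi$; $\mathsf K=\mathsf k$, $\mathsf S=\mathsf s$; $\mathrm{QP}=\Phi$. Then $\mathcal K_{\mathcal A\bullet}$ is an abstract Krivine structure.
   Context: A full adjunction implicative ordered combinatory algebra is an inf-complete poset $(A,\le)$ with application $(a,b)\mapsto ab$ monotone in both arguments (associating to the left), implication $(a,b)\mapsto a\to b$ antimonotone in the first and monotone in the second argument (associating to the right), elements $\mathsf k,\mathsf s$ with $\mathsf k ab\le a$ and $\mathsf s abc\le ac(bc)$ for all $a,b,c$, such that $a\le b\to c$ implies $ab\le c$, and $ab\le c$ implies $a\le b\to c$, and a subset $\Phi\subseteq A$ closed under application containing $\mathsf s,\mathsf k$. An abstract Krivine structure consists of sets $\Lambda,\Pi$, a relation $\perp\subseteq\Lambda\times\Pi$, a map $\mathrm{push}:\Lambda\times\Pi\to\Pi$ written $t\cdot\pi$ (associating to the right), an application $\Lambda\times\Lambda\to\Lambda$ written $ts$, a subset $\mathrm{QP}\subseteq\Lambda$ closed under application, and $\mathsf K,\mathsf S\in\mathrm{QP}$ such that for all $t,s,u\in\Lambda,\pi\in\Pi$: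 $t\perp s\cdot\pi\Rightarrow ts\perp\pi$; $t\perp\pi\Rightarrow\mathsf K\perp t\cdot s\cdot\pi$; $tu(su)\perp\pi\Rightarrow\mathsf S\perp t\cdot s\cdot u\cdot\pi$. -}

module Defs where

open import Data.Product using (∃; _×_)
open import Level using (Level; _⊔_; suc)
open import Relation.Binary.Bundles using (Setoid; Poset)
open import Relation.Binary.Core using (REL; _Preserves₂_⟶_⟶_)
open import Relation.Binary.Definitions
  using (Monotonic₂; AntitonicMonotonic; _Respects_; _Respectsˡ_; _Respectsʳ_)
open import Relation.Unary using (Pred; _∈_)

-- Sets are setoids throughout: a subset or relation is one that respects the
-- setoid equality, and a map is one that preserves it.

module _ {c ℓ₁ ℓ₂ p : Level} (P : Poset c ℓ₁ ℓ₂) where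

  open Poset P

  IsInfimum : Pred Carrier p → Carrier → Set (c ⊔ ℓ₂ ⊔ p)
  IsInfimum X m = (∀ {x} → x ∈ X → m ≤ x)
                × (∀ {z} → (∀ {x} → x ∈ X → z ≤ x) → z ≤ m)

-- The level p bounds the subsets that are considered.
InfComplete : ∀ {c ℓ₁ ℓ₂} (p : Level) → Poset c ℓ₁ ℓ₂ → Set (c ⊔ ℓ₁ ⊔ ℓ₂ ⊔ suc p)
InfComplete p P = (X : Pred Carrier p) → X Respects _≈_ → ∃ λ m → IsInfimum P X m
  where open Poset P

-- Congruence of _∙_ and _⇒_ for _≈_ is not a field: it follows from
-- monotonicity and antisymmetry.
record FullAdjunctionIOCA (c ℓ₁ ℓ₂ p : Level) : Set (suc (c ⊔ ℓ₁ ⊔ ℓ₂ ⊔ p)) where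

  infixl 9 _∙_
  infixr 5 _⇒_

  field
    poset : Poset c ℓ₁ ℓ₂

  open Poset poset public

  field
    infComplete : InfComplete p poset
    _∙_         : Carrier → Carrier → Carrier
    _⇒_         : Carrier → Carrier → Carrier
    k s         : Carrier
    Φ           : Pred Carrier p

    ∙-mono      : Monotonic₂ _≤_ _≤_ _≤_ _∙_
    ⇒-anti-mono : AntitonicMonotonic _≤_ _≤_ _≤_ _⇒_
    k-law       : ∀ a b → k ∙ a ∙ b ≤ a
    s-law       : ∀ a b c → s ∙ a ∙ b ∙ c ≤ a ∙ c ∙ (b ∙ c)
    ⇒-to-∙      : ∀ a b c → a ≤ b ⇒ c → a ∙ b ≤ c
    ∙-to-⇒      : ∀ a b c → a ∙ b ≤ c → a ≤ b ⇒ c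
    Φ-resp-≈    : Φ Respects _≈_
    Φ-closed    : ∀ {a b} → a ∈ Φ → b ∈ Φ → a ∙ b ∈ Φ
    s∈Φ         : s ∈ Φ
    k∈Φ         : k ∈ Φ

record RawKrivineStructure (a ℓa b ℓb r q : Level)
       : Set (suc (a ⊔ ℓa ⊔ b ⊔ ℓb ⊔ r ⊔ q)) where

  infixl 9 _⊙_
  infixr 5 _·_
  infix  4 _⊥_

  field
    Λ : Setoid a ℓa
    Π : Setoid b ℓb

  module Λ = Setoid Λ
  module Π = Setoid Π

  field
    _⊥_ : REL Λ.Carrier Π.Carrier r
    _⊙_ : Λ.Carrier → Λ.Carrier → Λ.Carrier
    _·_ : Λ.Carrier → Π.Carrier → Π.Carrier
    K S : Λ.Carrier
    QP  : Pred Λ.Carrier q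

record IsAbstractKrivineStructure {a ℓa b ℓb r q : Level}
       (𝒦 : RawKrivineStructure a ℓa b ℓb r q)
       : Set (a ⊔ ℓa ⊔ b ⊔ ℓb ⊔ r ⊔ q) where

  open RawKrivineStructure 𝒦

  field
    ⊥-respˡ-≈ : _⊥_ Respectsˡ Λ._≈_
    ⊥-respʳ-≈ : _⊥_ Respectsʳ Π._≈_
    ⊙-cong    : _⊙_ Preserves₂ Λ._≈_ ⟶ Λ._≈_ ⟶ Λ._≈_
    ·-cong    : _·_ Preserves₂ Λ._≈_ ⟶ Π._≈_ ⟶ Π._≈_
    QP-resp-≈ : QP Respects Λ._≈_

    QP-closed : ∀ {t u} → t ∈ QP → u ∈ QP → t ⊙ u ∈ QP
    K∈QP      : K ∈ QP
    S∈QP      : S ∈ QP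
    push-law  : ∀ t s π → t ⊥ s · π → t ⊙ s ⊥ π
    K-law     : ∀ t s π → t ⊥ π → K ⊥ t · s · π
    S-law     : ∀ t s u π → t ⊙ u ⊙ (s ⊙ u) ⊥ π → S ⊥ t · s · u · π

𝒦• : ∀ {c ℓ₁ ℓ₂ p} → FullAdjunctionIOCA c ℓ₁ ℓ₂ p → RawKrivineStructure c ℓ₁ c ℓ₁ ℓ₂ p
𝒦• 𝒜 = record
  { Λ   = Eq.setoid
  ; Π   = Eq.setoid
  ; _⊥_ = _≤_
  ; _⊙_ = _∙_
  ; _·_ = _⇒_
  ; K   = k
  ; S   = s
  ; QP  = Φ
  }
  where open FullAdjunctionIOCA 𝒜

{-# OPTIONS --safe #-}
module Submission where

open import Defs
open import Relation.Binary.Core using (_Preserves₂_⟶_⟶_)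

-- With `≤` as orthogonality and `⇒` as push, the push law is one half of the adjunction, `⇒-to-∙`.
-- The laws for `K` and `S` come from the other half: the combinator inequality bounds the fully
-- applied combinator, and currying moves its arguments across `≤`.

module _ {c ℓ₁ ℓ₂ p} (𝒜 : FullAdjunctionIOCA c ℓ₁ ℓ₂ p) where

  open FullAdjunctionIOCA 𝒜

  ∙-cong : _∙_ Preserves₂ _≈_ ⟶ _≈_ ⟶ _≈_
  ∙-cong a≈a′ b≈b′ = antisym
    (∙-mono (reflexive a≈a′) (reflexive b≈b′))
    (∙-mono (reflexive (Eq.sym a≈a′)) (reflexive (Eq.sym b≈b′)))

  ⇒-cong : _⇒_ Preserves₂ _≈_ ⟶ _≈_ ⟶ _≈_
  ⇒-cong a≈a′ b≈b′ = antisym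
    -- Antitonicity on the left makes the first equality enter reversed.
    (⇒-anti-mono (reflexive (Eq.sym a≈a′)) (reflexive b≈b′))
    (⇒-anti-mono (reflexive a≈a′) (reflexive (Eq.sym b≈b′)))

  k≤ : ∀ t u π → t ≤ π → k ≤ t ⇒ u ⇒ π
  -- From `k ∙ t ∙ u ≤ t ≤ π`, the inner `∙-to-⇒` moves `u` across, the outer one `t`.
  k≤ t u π t≤π = ∙-to-⇒ _ _ _ (∙-to-⇒ _ _ _ (trans (k-law t u) t≤π))

  s≤ : ∀ t u v π → t ∙ v ∙ (u ∙ v) ≤ π → s ≤ t ⇒ u ⇒ v ⇒ π
  s≤ t u v π tv[uv]≤π =
    ∙-to-⇒ _ _ _ (∙-to-⇒ _ _ _ (∙-to-⇒ _ _ _ (trans (s-law t u v) tv[uv]≤π)))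

mainTheorem11 : ∀ {c ℓ₁ ℓ₂ p} (𝒜 : FullAdjunctionIOCA c ℓ₁ ℓ₂ p) → IsAbstractKrivineStructure (𝒦• 𝒜)
mainTheorem11 𝒜 = record
  { ⊥-respˡ-≈ = ≤-respˡ-≈
  ; ⊥-respʳ-≈ = ≤-respʳ-≈
  ; ⊙-cong    = ∙-cong 𝒜
  ; ·-cong    = ⇒-cong 𝒜
  ; QP-resp-≈ = Φ-resp-≈
  ; QP-closed = Φ-closed
  ; K∈QP      = k∈Φ
  ; S∈QP      = s∈Φ
  ; push-law  = ⇒-to-∙
  ; K-law     = k≤ 𝒜
  ; S-law     = s≤ 𝒜
  }
  where open FullAdjunctionIOCA 𝒜
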